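{- Let $\mathscr{A}=(G,\partial)$ be a unicyclization of a connected graph $G$, let $\beta$ be a basis of $Z_1(G)=\ker\partial_1$, and let $\sigma$ be an edge of $G$ that is not a loop. Let $G_c=G/\sigma$. Then there are a unicyclization $\mathscr{A}_c=(G_c,\partial_c)$ of $G_c$ and a basis $\beta_c$ of $Z_1(G_c)$ such that for every $C\in\ker\partial_1$, $$[C]_\beta=[C_c]_{\beta_c}\quad\text{and}\quad w_{\mathscr{A}}(C)=w_{\mathscr{A}_c}(C_c),$$ where $C_c\in\mathbb{Z}^{E(G_c)}$ is the vector obtained from $C$ by deleting the entry at $\sigma$.
   Context: Graphs are finite and connected; loops and multiple edges are allowed. Fix an orientation of each edge. $\partial_1:\mathbb{Z}^{E(G)}\to\mathbb{Z}^{V(G)}$ is the (oriented) incidence matrix (a loop gives a zero column). $Z_1(G)=\ker\partial_1$ is a free abelian group of rank $m=|E(G)|-|V(G)|+1$; bases are ordered $\mathbb{Z}$-bases. $G/\sigma$ is obtained by removing the non-loop edge $\sigma$ and identifying its two end vertices (so $E(G/\sigma)=E(G)\setminus\{\sigma\}$, with inherited orientations). A unicyclizer of $G$ is an integer matrix $\partial$ (rows indexed by $E(G)$) with (1) $\ker\partial=0$, (2) $\partial_1\partial=0$, (3) $\operatorname{rk}(\ker\partial_1/\operatorname{im}\partial)=1$. So $\partial$ has $m-1$ linearly independent columns, all in $Z_1(G)$. The pair $\mathscr{A}=(G,\partial)$ is called a unicyclization of $G$. For a basis $\beta$ of $Z_1(G)$, $[z]_\beta\in\mathbb{Z}^m$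 is the coordinate column vector of $z\in Z_1(G)$, and $[\partial]_\beta$ is the $m\times(m-1)$ matrix whose columns are the coordinate vectors of the columns of $\partial$. The winding number map of $\mathscr{A}$ relative to $\beta$ is $w_{\mathscr{A}}(z)=\det([z]_\beta,[\partial]_\beta)$ (first column $[z]_\beta$); $w_{\mathscr{A}_c}$ is taken relative to $\beta_c$. -}

module Defs where

open import Algebra.Bundles using (AbelianGroup)
open import Algebra.Module.Bundles using (LeftModule)
import Algebra.Construct.Pointwise as Pointwise
import Algebra.Definitions.RawMonoid as RawMonoidDefs
import Algebra.Module.Properties.LeftModule as LeftModuleProperties
import Algebra.Properties.AbelianGroup as AbelianGroupProperties
import Algebra.Properties.CommutativeSemigroup as CommutativeSemigroupProperties
open import Data.Fin.Base using (Fin; zero; suc; toℕ; punchIn; punchOut)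
open import Data.Fin.Properties
  using (_≟_; punchInᵢ≢i; punchIn-punchOut; punchOut-cong; punchOut-punchIn)
open import Data.Integer.Base using (ℤ; 0ℤ; 1ℤ; -1ℤ; _+_; _-_; _*_; -_; _^_)
open import Data.Integer.Properties as ℤ using (+-*-ring; +-*-semiring; +-0-abelianGroup)
open import Data.Nat.Base using (ℕ; zero; suc)
open import Data.Product.Base using (Σ; ∃-syntax; _×_; _,_; proj₁; proj₂)
open import Data.Vec.Functional using (Vector; _∷_; map)
open import Function.Base using (_∘_; _on_)
open import Level using (0ℓ)
open import Relation.Binary.Construct.Closure.Equivalence as EqClosure using (EqClosure)
open import Relation.Binary.Core using (Rel)
open import Relation.Binary.PropositionalEquality
open import Relation.Nullary using (¬_; yes; no; contradiction)
open import Algebra.Properties.Semiring.Sum +-*-semiring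
  using (sum; sum-cong-≗; *-distribˡ-sum; ∑-distrib-+; sum-replicate-zero)

------------------------------------------------------------------------
-- Modules over ℤ (i.e. abelian groups)

ℤ-Module : Set₁
ℤ-Module = LeftModule +-*-ring 0ℓ 0ℓ

-- As with any family indexed by Fin r, the families below are ordered.
module _ (M : ℤ-Module) where
  open LeftModule M

  linComb : ∀ {r} → Vector ℤ r → Vector Carrierᴹ r → Carrierᴹ
  linComb c x = RawMonoidDefs.sum +ᴹ-rawMonoid (λ i → c i *ₗ x i)

  LinearlyIndependent : ∀ {r} → Vector Carrierᴹ r → Set
  LinearlyIndependent x = ∀ c → linComb c x ≈ᴹ 0ᴹ → ∀ i → c i ≡ 0ℤ

  LinearlyDependent : ∀ {r} → Vector Carrierᴹ r → Set
  LinearlyDependent x = ∃[ c ] (∃[ i ] c i ≢ 0ℤ) × linComb c x ≈ᴹ 0ᴹ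

  record Basis (r : ℕ) : Set where
    field
      vectors     : Vector Carrierᴹ r
      independent : LinearlyIndependent vectors
      spanning    : ∀ z → ∃[ c ] linComb c vectors ≈ᴹ z

    coordinates : Carrierᴹ → Vector ℤ r
    coordinates z = proj₁ (spanning z)

  -- The rank is the largest size of a linearly independent family.
  HasRank : ℕ → Set
  HasRank r = (∃[ x ] LinearlyIndependent {r} x) ×
              (∀ x → LinearlyDependent {suc r} x)

record Submodule (M : ℤ-Module) : Set₁ where
  open LeftModule M
  field
    Member   : Carrierᴹ → Set
    resp-≈   : ∀ {x y} → x ≈ᴹ y → Member x → Member y
    0-closed : Member 0ᴹ
    +-closed : ∀ {x y} → Member x → Member y → Member (x +ᴹ y)
    *-closed : ∀ a {x} → Member x → Member (a *ₗ x)

  neg-closed : ∀ {x} → Member x → Member (-ᴹ x)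
  neg-closed {x} x∈ = resp-≈ (inverseʳ-uniqueᴹ x (-1ℤ *ₗ x) x+[-1]x≈0) (*-closed -1ℤ x∈)
    where
    open LeftModuleProperties M using (inverseʳ-uniqueᴹ)
    x+[-1]x≈0 : x +ᴹ (-1ℤ *ₗ x) ≈ᴹ 0ᴹ
    x+[-1]x≈0 = ≈ᴹ-trans (+ᴹ-congʳ (≈ᴹ-sym (*ₗ-identityˡ x)))
               (≈ᴹ-trans (≈ᴹ-sym (*ₗ-distribʳ x 1ℤ -1ℤ)) (*ₗ-zeroˡ x))

-- A submodule as a module in its own right.
toModule : {M : ℤ-Module} → Submodule M → ℤ-Module
toModule {M} S = record
  { Carrierᴹ = Σ Carrierᴹ Member
  ; _≈ᴹ_ = _≈ᴹ_ on proj₁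
  ; _+ᴹ_ = λ (x , x∈) (y , y∈) → x +ᴹ y , +-closed x∈ y∈
  ; _*ₗ_ = λ a (x , x∈) → a *ₗ x , *-closed a x∈
  ; 0ᴹ = 0ᴹ , 0-closed
  ; -ᴹ_ = λ (x , x∈) → -ᴹ x , neg-closed x∈
  ; isLeftModule = record
    { isLeftSemimodule = record
      { +ᴹ-isCommutativeMonoid = record
        { isMonoid = record
          { isSemigroup = record
            { isMagma = record
              { isEquivalence = record { refl = ≈ᴹ-refl ; sym = ≈ᴹ-sym ; trans = ≈ᴹ-trans }
              ; ∙-cong = +ᴹ-cong
              }
            ; assoc = λ _ _ _ → +ᴹ-assoc _ _ _
            }
          ; identity = (λ _ → +ᴹ-identityˡ _) , (λ _ → +ᴹ-identityʳ _)
          }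
        ; comm = λ _ _ → +ᴹ-comm _ _
        }
      ; isPreleftSemimodule = record
        { *ₗ-cong = *ₗ-cong
        ; *ₗ-zeroˡ = λ _ → *ₗ-zeroˡ _
        ; *ₗ-distribʳ = λ _ _ _ → *ₗ-distribʳ _ _ _
        ; *ₗ-identityˡ = λ _ → *ₗ-identityˡ _
        ; *ₗ-assoc = λ _ _ _ → *ₗ-assoc _ _ _
        ; *ₗ-zeroʳ = λ _ → *ₗ-zeroʳ _
        ; *ₗ-distribˡ = λ _ _ _ → *ₗ-distribˡ _ _ _
        }
      }
    ; -ᴹ‿cong = -ᴹ‿cong
    ; -ᴹ‿inverse = (λ _ → -ᴹ‿inverseˡ _) , (λ _ → -ᴹ‿inverseʳ _)
    }
  }
  where
  open LeftModule M
  open Submodule S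

-- The preimage of T under the inclusion of S.
restrict : {M : ℤ-Module} (S T : Submodule M) → Submodule (toModule S)
restrict S T = record
  { Member   = λ (x , _) → T.Member x
  ; resp-≈   = λ x≈y → T.resp-≈ x≈y
  ; 0-closed = T.0-closed
  ; +-closed = λ x∈ y∈ → T.+-closed x∈ y∈
  ; *-closed = λ a x∈ → T.*-closed a x∈
  }
  where module T = Submodule T

-- The quotient M / S: the same elements, with x and y equal when x - y ∈ S.
quotient : (M : ℤ-Module) → Submodule M → ℤ-Module
quotient M S = record
  { Carrierᴹ = Carrierᴹ
  ; _≈ᴹ_ = _∼_
  ; _+ᴹ_ = _+ᴹ_
  ; _*ₗ_ = _*ₗ_
  ; 0ᴹ = 0ᴹ
  ; -ᴹ_ = -ᴹ_
  ; isLeftModule = record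
    { isLeftSemimodule = record
      { +ᴹ-isCommutativeMonoid = record
        { isMonoid = record
          { isSemigroup = record
            { isMagma = record
              { isEquivalence = record { refl = ≈⇒∼ ≈ᴹ-refl ; sym = ∼-sym ; trans = ∼-trans }
              ; ∙-cong = +-cong
              }
            ; assoc = λ x y z → ≈⇒∼ (+ᴹ-assoc x y z)
            }
          ; identity = (λ x → ≈⇒∼ (+ᴹ-identityˡ x)) , (λ x → ≈⇒∼ (+ᴹ-identityʳ x))
          }
        ; comm = λ x y → ≈⇒∼ (+ᴹ-comm x y)
        }
      ; isPreleftSemimodule = record
        { *ₗ-cong = λ { {a} refl x∼y → *-cong a x∼y }
        ; *ₗ-zeroˡ = λ x → ≈⇒∼ (*ₗ-zeroˡ x)
        ; *ₗ-distribʳ = λ x a b → ≈⇒∼ (*ₗ-distribʳ x a b)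
        ; *ₗ-identityˡ = λ x → ≈⇒∼ (*ₗ-identityˡ x)
        ; *ₗ-assoc = λ a b x → ≈⇒∼ (*ₗ-assoc a b x)
        ; *ₗ-zeroʳ = λ a → ≈⇒∼ (*ₗ-zeroʳ a)
        ; *ₗ-distribˡ = λ a x y → ≈⇒∼ (*ₗ-distribˡ a x y)
        }
      }
    ; -ᴹ‿cong = λ {x} {y} x∼y → resp-≈ (≈ᴹ-sym (⁻¹-∙-comm x (-ᴹ y))) (neg-closed x∼y)
    ; -ᴹ‿inverse = (λ x → ≈⇒∼ (-ᴹ‿inverseˡ x)) , (λ x → ≈⇒∼ (-ᴹ‿inverseʳ x))
    }
  }
  where
  open LeftModule M
  open Submodule S
  open AbelianGroupProperties +ᴹ-abelianGroup using (⁻¹-∙-comm; ⁻¹-involutive)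
  open CommutativeSemigroupProperties (AbelianGroup.commutativeSemigroup +ᴹ-abelianGroup)
    using (interchange)

  _∼_ : Rel Carrierᴹ 0ℓ
  x ∼ y = Member (x +ᴹ -ᴹ y)

  ≈⇒∼ : ∀ {x y} → x ≈ᴹ y → x ∼ y
  ≈⇒∼ {x} {y} x≈y = resp-≈ (≈ᴹ-sym (≈ᴹ-trans (+ᴹ-congʳ x≈y) (-ᴹ‿inverseʳ y))) 0-closed

  ∼-sym : ∀ {x y} → x ∼ y → y ∼ x
  ∼-sym {x} {y} x∼y = resp-≈
    (≈ᴹ-trans (≈ᴹ-sym (⁻¹-∙-comm x (-ᴹ y)))
    (≈ᴹ-trans (+ᴹ-congˡ (⁻¹-involutive y)) (+ᴹ-comm (-ᴹ x) y)))
    (neg-closed x∼y)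

  ∼-trans : ∀ {x y z} → x ∼ y → y ∼ z → x ∼ z
  ∼-trans {x} {y} {z} x∼y y∼z = resp-≈
    (≈ᴹ-trans (+ᴹ-assoc x (-ᴹ y) (y +ᴹ -ᴹ z))
    (+ᴹ-congˡ (≈ᴹ-trans (≈ᴹ-sym (+ᴹ-assoc (-ᴹ y) y (-ᴹ z)))
              (≈ᴹ-trans (+ᴹ-congʳ (-ᴹ‿inverseˡ y)) (+ᴹ-identityˡ (-ᴹ z))))))
    (+-closed x∼y y∼z)

  +-cong : ∀ {x x′ y y′} → x ∼ x′ → y ∼ y′ → (x +ᴹ y) ∼ (x′ +ᴹ y′)
  +-cong {x} {x′} {y} {y′} x∼x′ y∼y′ = resp-≈
    (≈ᴹ-trans (interchange x (-ᴹ x′) y (-ᴹ y′)) (+ᴹ-congˡ (⁻¹-∙-comm x′ y′)))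
    (+-closed x∼x′ y∼y′)

  *-cong : ∀ a {x y} → x ∼ y → (a *ₗ x) ∼ (a *ₗ y)
  *-cong a {x} {y} x∼y = resp-≈
    (≈ᴹ-trans (*ₗ-distribˡ a x (-ᴹ y)) (+ᴹ-congˡ a[-y]≈-ay))
    (*-closed a x∼y)
    where
    open LeftModuleProperties M using (inverseʳ-uniqueᴹ)
    a[-y]≈-ay : a *ₗ (-ᴹ y) ≈ᴹ -ᴹ (a *ₗ y)
    a[-y]≈-ay = inverseʳ-uniqueᴹ (a *ₗ y) (a *ₗ (-ᴹ y))
      (≈ᴹ-trans (≈ᴹ-sym (*ₗ-distribˡ a y (-ᴹ y)))
      (≈ᴹ-trans (*ₗ-cong refl (-ᴹ‿inverseʳ y)) (*ₗ-zeroʳ a)))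

-- ℤⁿ, with pointwise equality.
ℤ^_ : ℕ → ℤ-Module
ℤ^ n = record
  { Carrierᴹ = Vector ℤ n
  ; _*ₗ_ = λ a → map (a *_)
  ; isLeftModule = record
    { isLeftSemimodule = record
      { +ᴹ-isCommutativeMonoid = isCommutativeMonoid
      ; isPreleftSemimodule = record
        { *ₗ-cong = λ a≡b x≗y i → cong₂ _*_ a≡b (x≗y i)
        ; *ₗ-zeroˡ = λ x i → ℤ.*-zeroˡ (x i)
        ; *ₗ-distribʳ = λ x a b i → ℤ.*-distribʳ-+ (x i) a b
        ; *ₗ-identityˡ = λ x i → ℤ.*-identityˡ (x i)
        ; *ₗ-assoc = λ a b x i → ℤ.*-assoc a b (x i)
        ; *ₗ-zeroʳ = λ a i → ℤ.*-zeroʳ a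
        ; *ₗ-distribˡ = λ a x y i → ℤ.*-distribˡ-+ a (x i) (y i)
        }
      }
    ; -ᴹ‿cong = ⁻¹-cong
    ; -ᴹ‿inverse = inverse
    }
  }
  where open AbelianGroup (Pointwise.abelianGroup (Fin n) +-0-abelianGroup)

------------------------------------------------------------------------
-- Integer matrices

Matrix : ℕ → ℕ → Set
Matrix m n = Fin m → Fin n → ℤ

infixr 7 _*ᵥ_ _*ₘ_

_*ᵥ_ : ∀ {m n} → Matrix m n → Vector ℤ n → Vector ℤ m
(A *ᵥ x) i = sum λ j → A i j * x j

_*ₘ_ : ∀ {l m n} → Matrix l m → Matrix m n → Matrix l n
(A *ₘ B) i k = sum λ j → A i j * B j k

column : ∀ {m n} → Matrix m n → Fin n → Vector ℤ m
column A j i = A i j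

-- Laplace expansion along the first row.
det : ∀ {n} → Matrix n n → ℤ
det {zero}  A = 1ℤ
det {suc n} A =
  sum λ j → (-1ℤ ^ toℕ j) * A zero j * det (λ i k → A (suc i) (punchIn j k))

module _ {m n} (A : Matrix m n) where

  *ᵥ-cong : ∀ {x y} → x ≗ y → A *ᵥ x ≗ A *ᵥ y
  *ᵥ-cong x≗y i = sum-cong-≗ λ j → cong (A i j *_) (x≗y j)

  *ᵥ-zero : ∀ i → (A *ᵥ λ _ → 0ℤ) i ≡ 0ℤ
  *ᵥ-zero i = trans (sum-cong-≗ λ j → ℤ.*-zeroʳ (A i j)) (sum-replicate-zero n)

  *ᵥ-+ : ∀ x y i → (A *ᵥ λ j → x j + y j) i ≡ (A *ᵥ x) i + (A *ᵥ y) i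
  *ᵥ-+ x y i = trans (sum-cong-≗ λ j → ℤ.*-distribˡ-+ (A i j) (x j) (y j))
                     (∑-distrib-+ (λ j → A i j * x j) (λ j → A i j * y j))

  *ᵥ-* : ∀ a x i → (A *ᵥ λ j → a * x j) i ≡ a * (A *ᵥ x) i
  *ᵥ-* a x i = trans (sum-cong-≗ λ j → x∙yz≈y∙xz (A i j) a (x j))
                     (sym (*-distribˡ-sum a (λ j → A i j * x j)))
    where open CommutativeSemigroupProperties ℤ.*-commutativeSemigroup using (x∙yz≈y∙xz)

  kernel : Submodule (ℤ^ n)
  kernel = record
    { Member   = λ x → ∀ i → (A *ᵥ x) i ≡ 0ℤ
    ; resp-≈   = λ x≗y x∈ i → trans (sym (*ᵥ-cong x≗y i)) (x∈ i)
    ; 0-closed = *ᵥ-zero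
    ; +-closed = λ {x} {y} x∈ y∈ i → trans (*ᵥ-+ x y i) (cong₂ _+_ (x∈ i) (y∈ i))
    ; *-closed = λ a {x} x∈ i →
        trans (*ᵥ-* a x i) (trans (cong (a *_) (x∈ i)) (ℤ.*-zeroʳ a))
    }

  image : Submodule (ℤ^ m)
  image = record
    { Member   = λ y → ∃[ x ] A *ᵥ x ≗ y
    ; resp-≈   = λ y≗z (x , Ax≗y) → x , λ i → trans (Ax≗y i) (y≗z i)
    ; 0-closed = (λ _ → 0ℤ) , *ᵥ-zero
    ; +-closed = λ (x , Ax≗y) (x′ , Ax′≗y′) →
        (λ j → x j + x′ j) , λ i → trans (*ᵥ-+ x x′ i) (cong₂ _+_ (Ax≗y i) (Ax′≗y′ i))
    ; *-closed = λ a (x , Ax≗y) →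
        (λ j → a * x j) , λ i → trans (*ᵥ-* a x i) (cong (a *_) (Ax≗y i))
    }

------------------------------------------------------------------------
-- Graphs

-- A finite connected multigraph, possibly with loops, with n vertices and
-- e edges; the edge a is oriented from source a to target a.
record Graph (n e : ℕ) : Set where
  field
    source target : Fin e → Fin n

  Adjacent : Rel (Fin n) 0ℓ
  Adjacent u v = ∃[ a ] source a ≡ u × target a ≡ v

  field
    connected : ∀ u v → EqClosure Adjacent u v

  IsLoop : Fin e → Set
  IsLoop a = source a ≡ target a

indicator : ∀ {n} → Fin n → Fin n → ℤ
indicator u v with u ≟ v
... | yes _ = 1ℤ
... | no  _ = 0ℤ

module _ {n e} (G : Graph n e) where
  open Graph G

  ∂₁ : Matrix n e
  ∂₁ v a = indicator (target a) v - indicator (source a) v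

  Z₁ : ℤ-Module
  Z₁ = toModule (kernel ∂₁)

  Cycle : Set
  Cycle = LeftModule.Carrierᴹ Z₁

  IsCycle : Vector ℤ e → Set
  IsCycle = Submodule.Member (kernel ∂₁)

-- Contraction of a non-loop edge σ. The vertex obtained by identifying the
-- ends of σ is represented by source σ, so target σ is dropped from Fin (suc n).
module _ {n e} (G : Graph (suc n) (suc e)) (σ : Fin (suc e))
         (σ-nonloop : ¬ Graph.IsLoop G σ) where
  open Graph G

  contractVertex : Fin (suc n) → Fin n
  contractVertex v with target σ ≟ v
  ... | yes _   = punchOut (σ-nonloop ∘ sym)
  ... | no  t≢v = punchOut t≢v

  contractVertex-≢ : ∀ {v} (t≢v : target σ ≢ v) → contractVertex v ≡ punchOut t≢v
  contractVertex-≢ {v} t≢v with target σ ≟ v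
  ... | yes t≡v = contradiction t≡v t≢v
  ... | no  _   = punchOut-cong (target σ) refl

  contractVertex-target : contractVertex (target σ) ≡ contractVertex (source σ)
  contractVertex-target with target σ ≟ target σ
  ... | yes _   = sym (contractVertex-≢ _)
  ... | no  t≢t = contradiction refl t≢t

  contractVertex-punchIn : ∀ w → contractVertex (punchIn (target σ) w) ≡ w
  contractVertex-punchIn w =
    trans (contractVertex-≢ (punchInᵢ≢i (target σ) w ∘ sym)) (punchOut-punchIn (target σ))

  contract : Graph n e
  contract = record
    { source    = source′
    ; target    = target′
    ; connected = λ u v → subst₂ (EqClosure Adjacent′)
        (contractVertex-punchIn u) (contractVertex-punchIn v)
        (EqClosure.gfold (EqClosure.isEquivalence Adjacent′) contractVertex image-adjacent
          (connected (punchIn (target σ) u) (punchIn (target σ) v)))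
    }
    where
    source′ target′ : Fin e → Fin n
    source′ a = contractVertex (source (punchIn σ a))
    target′ a = contractVertex (target (punchIn σ a))

    Adjacent′ : Rel (Fin n) 0ℓ
    Adjacent′ u v = ∃[ a ] source′ a ≡ u × target′ a ≡ v

    image-adjacent : ∀ {u v} → Adjacent u v →
                     EqClosure Adjacent′ (contractVertex u) (contractVertex v)
    image-adjacent (a , refl , refl) with σ ≟ a
    ... | yes refl = subst (EqClosure Adjacent′ _) (sym contractVertex-target)
                           (EqClosure.reflexive Adjacent′)
    ... | no  σ≢a  = EqClosure.return
      (punchOut σ≢a , cong (contractVertex ∘ source) (punchIn-punchOut σ≢a)
                    , cong (contractVertex ∘ target) (punchIn-punchOut σ≢a))

------------------------------------------------------------------------
-- Unicyclizations

module _ {n e} (G : Graph n e) where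

  record IsUnicyclizer {k} (∂ : Matrix e k) : Set where
    field
      ker∂≡0  : ∀ x → (∀ a → (∂ *ᵥ x) a ≡ 0ℤ) → ∀ j → x j ≡ 0ℤ
      ∂₁∂≡0   : ∀ v j → (∂₁ G *ₘ ∂) v j ≡ 0ℤ
      corank₁ : HasRank (quotient (Z₁ G) (restrict (kernel (∂₁ G)) (image ∂))) 1

  -- The unicyclizations (G, ∂) in which ∂ has k columns; necessarily
  -- k = e - n, so that bases of Z₁ G have suc k elements.
  record Unicyclization (k : ℕ) : Set where
    field
      ∂             : Matrix e k
      isUnicyclizer : IsUnicyclizer ∂

    open IsUnicyclizer isUnicyclizer public

    columnCycle : Fin k → Cycle G
    columnCycle j = column ∂ j , λ v → ∂₁∂≡0 v j

  windingNumber : ∀ {k} → Unicyclization k → Basis (Z₁ G) (suc k) → Cycle G → ℤ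
  windingNumber {k} 𝒜 β z = det augmented
    where
    open Unicyclization 𝒜
    open Basis β

    augmented : Matrix (suc k) (suc k)
    augmented i = coordinates z i ∷ λ j → coordinates (columnCycle j) i

{-# OPTIONS --safe #-}
-- Deleting the entry at σ is an isomorphism Z₁ G → Z₁ (G/σ): a cycle is
-- determined by its entries off σ through the boundary equation at target σ,
-- and the rows of the incidence matrix of G/σ are those of G, the row of
-- target σ being added to that of source σ. Transport β along this isomorphism
-- and delete the row σ of ∂; all coordinates, hence also the determinants, are
-- then unchanged.
module Submission where

open import Defs
open import Algebra.Module.Bundles using (LeftModule)
import Algebra.Module.Morphism.Structures as MorphismStructures
import Algebra.Properties.AbelianGroup as AbelianGroupProperties
import Algebra.Properties.CommutativeMonoid.Sum as CommutativeMonoidSum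
open import Data.Empty using (⊥-elim)
open import Data.Fin.Base using (Fin; zero; suc; toℕ; punchIn; punchOut)
open import Data.Fin.Properties using (_≟_; punchIn-injective; punchInᵢ≢i; punchIn-punchOut)
open import Data.Integer.Base using (ℤ; 0ℤ; 1ℤ; -1ℤ; _+_; _-_; _*_; -_; _^_)
import Data.Integer.Properties as ℤ
open import Data.Integer.Tactic.RingSolver using (solve-∀)
open import Data.Nat.Base using (ℕ; zero; suc)
open import Data.Product.Base using (Σ-syntax; ∃-syntax; _×_; _,_; proj₁; proj₂)
open import Data.Vec.Functional using (Vector; _∷_; removeAt)
open import Function.Base using (_∘_)
open import Relation.Binary.PropositionalEquality
open import Relation.Nullary using (¬_; yes; no)
open import Algebra.Properties.Semiring.Sum ℤ.+-*-semiring
  using (sum; sum-cong-≗; *-distribˡ-sum; *-distribʳ-sum; ∑-distrib-+; ∑-comm; sum-remove;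
         sum-replicate-zero)

-- Linear combinations and uniqueness of coefficients.

module _ (M : ℤ-Module) where
  open LeftModule M
  open CommutativeMonoidSum +ᴹ-commutativeMonoid using ()
    renaming (sum-cong-≋ to sumᴹ-cong; ∑-distrib-+ to ∑ᴹ-distrib-+)
  open AbelianGroupProperties +ᴹ-abelianGroup using (identityˡ-unique)

  linComb-cong : ∀ {r} {c d : Vector ℤ r} {x y : Vector Carrierᴹ r} → c ≗ d →
                 (∀ i → x i ≈ᴹ y i) → linComb M c x ≈ᴹ linComb M d y
  linComb-cong c≗d x≈y = sumᴹ-cong λ i → *ₗ-cong (c≗d i) (x≈y i)

  linComb-+ : ∀ {r} (c d : Vector ℤ r) (x : Vector Carrierᴹ r) →
              linComb M (λ i → c i + d i) x ≈ᴹ linComb M c x +ᴹ linComb M d x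
  linComb-+ c d x = ≈ᴹ-trans (sumᴹ-cong λ i → *ₗ-distribʳ (x i) (c i) (d i))
                             (∑ᴹ-distrib-+ (λ i → c i *ₗ x i) (λ i → d i *ₗ x i))

  linComb-injective : ∀ {r} {x : Vector Carrierᴹ r} → LinearlyIndependent M x →
                      ∀ c d → linComb M c x ≈ᴹ linComb M d x → c ≗ d
  linComb-injective {x = x} indep c d eq i =
    ℤ.i-j≡0⇒i≡j (c i) (d i) (indep (λ i → c i - d i) difference≈0 i)
    where
    difference≈0 : linComb M (λ i → c i - d i) x ≈ᴹ 0ᴹ
    -- Adding the combination of `d` to that of `c - d` gives the combination of `c`, which by `eq`
    -- is that of `d` again; so the first summand is the identity.
    difference≈0 = identityˡ-unique _ _
      (≈ᴹ-trans (≈ᴹ-sym (linComb-+ (λ i → c i - d i) d x))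
      (≈ᴹ-trans (linComb-cong {x = x} (λ i → i-j+j≡i (c i) (d i)) (λ _ → ≈ᴹ-refl)) eq))
      where
      i-j+j≡i : ∀ i j → (i - j) + j ≡ i
      i-j+j≡i = solve-∀

-- Transport of ranks, bases and coordinates along isomorphisms.

module _ (M N : ℤ-Module) where
  private
    module M = LeftModule M
    module N = LeftModule N
  open MorphismStructures.LeftModuleMorphisms M.rawLeftModule N.rawLeftModule

  linComb-homo : ∀ {f} → IsLeftModuleHomomorphism f →
                 ∀ {r} (c : Vector ℤ r) (x : Vector M.Carrierᴹ r) →
                 f (linComb M c x) N.≈ᴹ linComb N c (f ∘ x)
  linComb-homo f-homo {zero}  c x = 0ᴹ-homo
    where open IsLeftModuleHomomorphism f-homo
  linComb-homo f-homo {suc r} c x =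
    N.≈ᴹ-trans (+ᴹ-homo _ _)
               (N.+ᴹ-cong (*ₗ-homo _ _) (linComb-homo f-homo (c ∘ suc) (x ∘ suc)))
    where open IsLeftModuleHomomorphism f-homo

  module _ {f} (f-iso : IsLeftModuleIsomorphism f) where
    open IsLeftModuleIsomorphism f-iso

    private
      f⁻¹ : N.Carrierᴹ → M.Carrierᴹ
      f⁻¹ y = proj₁ (surjective y)

      f∘f⁻¹ : ∀ y → f (f⁻¹ y) N.≈ᴹ y
      f∘f⁻¹ y = proj₂ (surjective y) M.≈ᴹ-refl

    independent-map : ∀ {r} {x : Vector M.Carrierᴹ r} →
                      LinearlyIndependent M x → LinearlyIndependent N (f ∘ x)
    independent-map {x = x} indep c fx≈0 = indep c
      (injective (N.≈ᴹ-trans (linComb-homo isLeftModuleHomomorphism c x)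
                 (N.≈ᴹ-trans fx≈0 (N.≈ᴹ-sym 0ᴹ-homo))))

    -- Independent families are pushed forward by `f`. For dependence, a family in `N` is pulled
    -- back to preimages, and a relation among these holds in `N` with the same coefficients.
    HasRank-map : ∀ {r} → HasRank M r → HasRank N r
    HasRank-map ((x , indep) , dep) = (f ∘ x , independent-map indep) , dep′
      where
      dep′ : ∀ y → LinearlyDependent N y
      dep′ y with dep (f⁻¹ ∘ y)
      ... | c , c≢0 , c·f⁻¹y≈0 = c , c≢0 ,
        N.≈ᴹ-trans (linComb-cong N {c = c} (λ _ → refl) (λ i → N.≈ᴹ-sym (f∘f⁻¹ (y i))))
        (N.≈ᴹ-trans (N.≈ᴹ-sym (linComb-homo isLeftModuleHomomorphism c (f⁻¹ ∘ y)))
        (N.≈ᴹ-trans (⟦⟧-cong c·f⁻¹y≈0) 0ᴹ-homo))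

    module _ {r} (β : Basis M r) where
      open Basis β

      Basis-map : Basis N r
      Basis-map = record
        { vectors     = f ∘ vectors
        ; independent = independent-map independent
        ; spanning    = λ y → coordinates (f⁻¹ y) ,
            N.≈ᴹ-trans (N.≈ᴹ-sym (linComb-homo isLeftModuleHomomorphism _ vectors))
            (N.≈ᴹ-trans (⟦⟧-cong (proj₂ (spanning (f⁻¹ y)))) (f∘f⁻¹ y))
        }

      -- The coordinates of `y` are by construction those of a chosen preimage, which need only be
      -- equal to `x` up to `≈ᴹ`. Injectivity of `f` supplies that equality, and independence makes
      -- the coefficients unique.
      coordinates-map : ∀ {x y} → f x N.≈ᴹ y → coordinates x ≗ Basis.coordinates Basis-map y
      coordinates-map {x} {y} fx≈y = linComb-injective M independent _ _
        (M.≈ᴹ-trans (proj₂ (spanning x))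
        (M.≈ᴹ-trans (injective (N.≈ᴹ-trans fx≈y (N.≈ᴹ-sym (f∘f⁻¹ y))))
                    (M.≈ᴹ-sym (proj₂ (spanning (f⁻¹ y))))))

-- Determinants, matrix products and indicators.

det-cong : ∀ {n} {A B : Matrix n n} → (∀ i j → A i j ≡ B i j) → det A ≡ det B
det-cong {zero}  A≗B = refl
det-cong {suc n} A≗B = sum-cong-≗ λ j →
  cong₂ _*_ (cong (-1ℤ ^ toℕ j *_) (A≗B zero j)) (det-cong λ i k → A≗B (suc i) (punchIn j k))

*ᵥ-*ₘ-assoc : ∀ {l m n} (A : Matrix l m) (B : Matrix m n) x →
              A *ᵥ B *ᵥ x ≗ (A *ₘ B) *ᵥ x
*ᵥ-*ₘ-assoc A B x i = begin
  sum (λ j → A i j * sum (λ k → B j k * x k))    ≡⟨ sum-cong-≗ (λ j → *-distribˡ-sum (A i j) λ k → B j k * x k) ⟩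
  sum (λ j → sum (λ k → A i j * (B j k * x k)))  ≡⟨ ∑-comm (λ j k → A i j * (B j k * x k)) ⟩
  sum (λ k → sum (λ j → A i j * (B j k * x k)))  ≡⟨ sum-cong-≗ (λ k → sum-cong-≗ λ j → sym (ℤ.*-assoc (A i j) (B j k) (x k))) ⟩
  sum (λ k → sum (λ j → A i j * B j k * x k))    ≡⟨ sum-cong-≗ (λ k → sym (*-distribʳ-sum (x k) λ j → A i j * B j k)) ⟩
  sum (λ k → sum (λ j → A i j * B j k) * x k)    ∎
  where open ≡-Reasoning

sum-zero : ∀ {n} {x : Vector ℤ n} → (∀ i → x i ≡ 0ℤ) → sum x ≡ 0ℤ
sum-zero {n} x≗0 = trans (sum-cong-≗ x≗0) (sum-replicate-zero n)

indicator-refl : ∀ {n} (u : Fin n) → indicator u u ≡ 1ℤ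
indicator-refl u with u ≟ u
... | yes _  = refl
... | no u≢u = ⊥-elim (u≢u refl)

indicator-≢ : ∀ {n} {u v : Fin n} → u ≢ v → indicator u v ≡ 0ℤ
indicator-≢ {u = u} {v} u≢v with u ≟ v
... | yes u≡v = ⊥-elim (u≢v u≡v)
... | no _    = refl

indicator-punchIn : ∀ {n} (t : Fin (suc n)) u v →
                    indicator (punchIn t u) (punchIn t v) ≡ indicator u v
indicator-punchIn t u v with u ≟ v
... | yes refl = indicator-refl (punchIn t u)
... | no u≢v   = indicator-≢ (u≢v ∘ punchIn-injective t u v)

-- The case split that fits contraction: it separates `σ` from the other edges, and the dropped
-- vertex `t` from those that remain.
punchIn-elim : ∀ {n} (i : Fin (suc n)) (P : Fin (suc n) → Set) →
               P i → (∀ j → P (punchIn i j)) → ∀ k → P k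
punchIn-elim i P Pi Pj k with i ≟ k
... | yes refl = Pi
... | no i≢k   = subst P (punchIn-punchOut i≢k) (Pj (punchOut i≢k))

-- Cycles of a graph and of its contraction.

module _ {n e} (G : Graph (suc n) (suc e)) (σ : Fin (suc e))
         (σ-nonloop : ¬ Graph.IsLoop G σ) where
  open Graph G

  private
    G/σ : Graph n e
    G/σ = contract G σ σ-nonloop

    s t : Fin (suc n)
    s = source σ
    t = target σ

    π : Fin (suc n) → Fin n
    π = contractVertex G σ σ-nonloop

  -- The fibre of `π` over `w` consists of `punchIn t w` and, exactly when `π s` is `w`, also of
  -- `t`. The second summand accounts for the former, the first for the latter.
  indicator-contract : ∀ u w →
    indicator (π u) w ≡ indicator (π s) w * indicator u t + indicator u (punchIn t w)
  indicator-contract u w = punchIn-elim t P at-t off-t u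
    where
    P : Fin (suc n) → Set
    P u = indicator (π u) w ≡ indicator (π s) w * indicator u t + indicator u (punchIn t w)

    x*1+0 : ∀ x → x ≡ x * 1ℤ + 0ℤ
    x*1+0 = solve-∀

    y≡x*0+y : ∀ x y → y ≡ x * 0ℤ + y
    y≡x*0+y = solve-∀

    at-t : P t
    at-t rewrite contractVertex-target G σ σ-nonloop
               | indicator-refl t
               | indicator-≢ (punchInᵢ≢i t w ∘ sym) = x*1+0 (indicator (π s) w)

    off-t : ∀ v → P (punchIn t v)
    off-t v rewrite contractVertex-punchIn G σ σ-nonloop v
                  | indicator-≢ (punchInᵢ≢i t v)
                  | indicator-punchIn t v w = y≡x*0+y (indicator (π s) w) (indicator v w)

  -- Stated for every edge of `G`, `σ` included, so that it applies under a sum over all edges; off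
  -- `σ` the left side is an entry of the incidence matrix of `G/σ`.
  ∂₁-contract : ∀ w a → indicator (π (target a)) w - indicator (π (source a)) w
                      ≡ indicator (π s) w * ∂₁ G t a + ∂₁ G (punchIn t w) a
  ∂₁-contract w a = trans
    (cong₂ _-_ (indicator-contract (target a) w) (indicator-contract (source a) w))
    (rearrange (indicator (π s) w) (indicator (target a) t) (indicator (target a) (punchIn t w))
                                   (indicator (source a) t) (indicator (source a) (punchIn t w)))
    where
    rearrange : ∀ p x x′ y y′ → (p * x + x′) - (p * y + y′) ≡ p * (x - y) + (x′ - y′)
    rearrange = solve-∀

  ∂₁-contract-*ᵥ : ∀ x w → (∂₁ G/σ *ᵥ removeAt x σ) w
    ≡ indicator (π s) w * (∂₁ G *ᵥ x) t + (∂₁ G *ᵥ x) (punchIn t w)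
  ∂₁-contract-*ᵥ x w = sym (begin
    p * (∂₁ G *ᵥ x) t + (∂₁ G *ᵥ x) (punchIn t w)
      ≡⟨ cong (_+ (∂₁ G *ᵥ x) (punchIn t w)) (*-distribˡ-sum p λ a → ∂₁ G t a * x a) ⟩
    sum (λ a → p * (∂₁ G t a * x a)) + (∂₁ G *ᵥ x) (punchIn t w)
      ≡⟨ ∑-distrib-+ (λ a → p * (∂₁ G t a * x a)) (λ a → ∂₁ G (punchIn t w) a * x a) ⟨
    sum (λ a → p * (∂₁ G t a * x a) + ∂₁ G (punchIn t w) a * x a)
      ≡⟨ sum-cong-≗ (λ a → trans (factor p (∂₁ G t a) (∂₁ G (punchIn t w) a) (x a)) (cong (_* x a) (sym (∂₁-contract w a)))) ⟩
    sum (λ a → D a * x a)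
      -- The terms off `σ` form the boundary in `G/σ`. The term at `σ` will vanish: both ends of `σ`
      -- have the same image under `π`.
      ≡⟨ sum-remove {i = σ} (λ a → D a * x a) ⟩
    D σ * x σ + (∂₁ G/σ *ᵥ removeAt x σ) w
      ≡⟨ cong (λ d → d * x σ + (∂₁ G/σ *ᵥ removeAt x σ) w) Dσ≡0 ⟩
    0ℤ * x σ + (∂₁ G/σ *ᵥ removeAt x σ) w
      ≡⟨ ℤ.+-identityˡ _ ⟩
    (∂₁ G/σ *ᵥ removeAt x σ) w ∎)
    where
    open ≡-Reasoning
    p : ℤ
    p = indicator (π s) w

    D : Fin (suc e) → ℤ
    D a = indicator (π (target a)) w - indicator (π (source a)) w

    Dσ≡0 : D σ ≡ 0ℤ
    Dσ≡0 = ℤ.i≡j⇒i-j≡0 (cong (λ v → indicator v w) (contractVertex-target G σ σ-nonloop))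

    factor : ∀ p y z x → p * (y * x) + z * x ≡ (p * y + z) * x
    factor = solve-∀

  removeAt-cycle : ∀ x → IsCycle G x → IsCycle G/σ (removeAt x σ)
  removeAt-cycle x x∈ w = trans (∂₁-contract-*ᵥ x w)
    (trans (cong₂ (λ y z → p * y + z) (x∈ t) (x∈ (punchIn t w))) (p*0+0 p))
    where
    p : ℤ
    p = indicator (π s) w

    p*0+0 : ∀ p → p * 0ℤ + 0ℤ ≡ 0ℤ
    p*0+0 = solve-∀

  -- As `σ` is not a loop, its coefficient at its target is 1, so the boundary equation at `t` can
  -- be solved for `x σ` over the integers.
  ∂₁-target : ∀ x → (∂₁ G *ᵥ x) t ≡ x σ + sum (λ a → ∂₁ G t (punchIn σ a) * removeAt x σ a)
  ∂₁-target x = trans (sum-remove {i = σ} (λ a → ∂₁ G t a * x a))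
    (cong (_+ rest) (trans (cong (_* x σ) ∂₁tσ≡1) (ℤ.*-identityˡ (x σ))))
    where
    rest : ℤ
    rest = sum λ a → ∂₁ G t (punchIn σ a) * removeAt x σ a

    ∂₁tσ≡1 : ∂₁ G t σ ≡ 1ℤ
    ∂₁tσ≡1 = cong₂ _-_ (indicator-refl t) (indicator-≢ σ-nonloop)

  cycle-zero : ∀ {x} → IsCycle G x → (∀ a → removeAt x σ a ≡ 0ℤ) → ∀ a → x a ≡ 0ℤ
  cycle-zero {x} x∈ x≗0 = punchIn-elim σ (λ a → x a ≡ 0ℤ) xσ≡0 x≗0
    where
    xσ≡0 : x σ ≡ 0ℤ
    xσ≡0 = begin
      x σ                                                    ≡⟨ ℤ.+-identityʳ (x σ) ⟨
      x σ + 0ℤ                                               ≡⟨ cong (x σ +_) rest≡0 ⟨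
      x σ + sum (λ a → ∂₁ G t (punchIn σ a) * removeAt x σ a)  ≡⟨ ∂₁-target x ⟨
      (∂₁ G *ᵥ x) t                                          ≡⟨ x∈ t ⟩
      0ℤ                                                     ∎
      where
      open ≡-Reasoning
      rest≡0 : sum (λ a → ∂₁ G t (punchIn σ a) * removeAt x σ a) ≡ 0ℤ
      rest≡0 = sum-zero λ a →
        trans (cong (∂₁ G t (punchIn σ a) *_) (x≗0 a)) (ℤ.*-zeroʳ (∂₁ G t (punchIn σ a)))

  cycle-difference : ∀ x y → IsCycle G x → IsCycle G y → IsCycle G λ a → x a - y a
  cycle-difference x y x∈ y∈ = +-closed {x} {λ a → - y a} x∈ (neg-closed {y} y∈)
    where open Submodule (kernel (∂₁ G))

  cycle-injective : ∀ x y → IsCycle G x → IsCycle G y → removeAt x σ ≗ removeAt y σ → x ≗ y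
  cycle-injective x y x∈ y∈ x≗y a = ℤ.i-j≡0⇒i≡j (x a) (y a)
    (cycle-zero (cycle-difference x y x∈ y∈) (λ b → ℤ.i≡j⇒i-j≡0 (x≗y b)) a)

  -- The entry at `σ` is forced by `∂₁-target`: it must be the negative of the contribution of the
  -- other edges at `t`.
  extend : ∀ y → IsCycle G/σ y → ∃[ x ] IsCycle G x × removeAt x σ ≗ y
  extend y y∈ = x , x∈ , x-off
    where
    rest : ℤ
    rest = sum λ a → ∂₁ G t (punchIn σ a) * y a

    x : Vector ℤ (suc e)
    x a with σ ≟ a
    ... | yes _  = - rest
    ... | no σ≢a = y (punchOut σ≢a)

    xσ : x σ ≡ - rest
    xσ with σ ≟ σ
    ... | yes _  = refl
    ... | no σ≢σ = ⊥-elim (σ≢σ refl)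

    x-off : removeAt x σ ≗ y
    x-off b with σ ≟ punchIn σ b
    ... | yes σ≡ = ⊥-elim (punchInᵢ≢i σ b (sym σ≡))
    ... | no σ≢  = cong y (punchIn-injective σ _ b (punchIn-punchOut σ≢))

    x∈t : (∂₁ G *ᵥ x) t ≡ 0ℤ
    x∈t = trans (∂₁-target x)
      (trans (cong₂ _+_ xσ (sum-cong-≗ λ a → cong (∂₁ G t (punchIn σ a) *_) (x-off a)))
             (ℤ.+-inverseˡ rest))

    x∈ : IsCycle G x
    -- The boundary at `t` vanishes by the choice of `x σ`. Elsewhere `∂₁-contract-*ᵥ` is read
    -- backwards: its multiple of the boundary at `t` is zero, so the boundary of `x` at
    -- `punchIn t w` is that of `y` at `w`.
    x∈ = punchIn-elim t (λ v → (∂₁ G *ᵥ x) v ≡ 0ℤ) x∈t λ w → begin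
      (∂₁ G *ᵥ x) (punchIn t w)
        ≡⟨ y≡p*0+y (indicator (π s) w) _ ⟩
      indicator (π s) w * 0ℤ + (∂₁ G *ᵥ x) (punchIn t w)
        ≡⟨ cong (λ z → indicator (π s) w * z + (∂₁ G *ᵥ x) (punchIn t w)) x∈t ⟨
      indicator (π s) w * (∂₁ G *ᵥ x) t + (∂₁ G *ᵥ x) (punchIn t w)
        ≡⟨ ∂₁-contract-*ᵥ x w ⟨
      (∂₁ G/σ *ᵥ removeAt x σ) w
        ≡⟨ *ᵥ-cong (∂₁ G/σ) x-off w ⟩
      (∂₁ G/σ *ᵥ y) w
        ≡⟨ y∈ w ⟩
      0ℤ ∎
      where
      open ≡-Reasoning
      y≡p*0+y : ∀ p y → y ≡ p * 0ℤ + y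
      y≡p*0+y = solve-∀

  -- Deletion of the entry at the contracted edge as an isomorphism.

  deleteσ : Cycle G → Cycle G/σ
  deleteσ (x , x∈) = removeAt x σ , removeAt-cycle x x∈

  private
    module _ (M N : ℤ-Module) where
      open MorphismStructures.LeftModuleMorphisms
        (LeftModule.rawLeftModule M) (LeftModule.rawLeftModule N) public
        using (IsLeftModuleIsomorphism)

  deleteσ-isIsomorphism : IsLeftModuleIsomorphism (Z₁ G) (Z₁ G/σ) deleteσ
  deleteσ-isIsomorphism = record
    { isLeftModuleMonomorphism = record
      { isLeftModuleHomomorphism = record
        { +ᴹ-isGroupHomomorphism = record
          { isMonoidHomomorphism = record
            { isMagmaHomomorphism = record
              { isRelHomomorphism = record { cong = λ x≗y a → x≗y (punchIn σ a) }
              ; homo = λ _ _ _ → refl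
              }
            ; ε-homo = λ _ → refl
            }
          ; ⁻¹-homo = λ _ _ → refl
          }
        ; *ₗ-homo = λ _ _ _ → refl
        }
      ; injective = λ {(x , x∈)} {(y , y∈)} → cycle-injective x y x∈ y∈
      }
    ; surjective = λ (y , y∈) → let x , x∈ , x≗y = extend y y∈ in
        (x , x∈) , λ z≗x a → trans (z≗x (punchIn σ a)) (x≗y a)
    }

  -- The contracted unicyclizer and its quotient.

  module _ {k} {∂ : Matrix (suc e) k} (∂-unicyclizer : IsUnicyclizer G ∂) where
    open IsUnicyclizer ∂-unicyclizer

    private
      ∂c : Matrix e k
      ∂c = ∂ ∘ punchIn σ

      Q : ℤ-Module
      Q = quotient (Z₁ G) (restrict (kernel (∂₁ G)) (image ∂))

      Qc : ℤ-Module
      Qc = quotient (Z₁ G/σ) (restrict (kernel (∂₁ G/σ)) (image ∂c))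

    image-cycle : ∀ c → IsCycle G (∂ *ᵥ c)
    image-cycle c v = trans (*ᵥ-*ₘ-assoc (∂₁ G) ∂ c v)
      (sum-zero λ j → trans (cong (_* c j) (∂₁∂≡0 v j)) (ℤ.*-zeroˡ (c j)))

    -- Equality in `Qc` is membership of the difference in the image of `∂c`; a zero difference is
    -- the image of the zero vector. The homomorphism laws, which hold entrywise, pass to the
    -- quotient this way.
    ≗⇒≈Qc : ∀ (x y : Cycle G/σ) → proj₁ x ≗ proj₁ y → LeftModule._≈ᴹ_ Qc x y
    ≗⇒≈Qc x y x≗y = (λ _ → 0ℤ) , λ a → trans (*ᵥ-zero ∂c a) (sym (ℤ.i≡j⇒i-j≡0 (x≗y a)))

    deleteσ-isIsomorphism-quotient : IsLeftModuleIsomorphism Q Qc deleteσ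
    deleteσ-isIsomorphism-quotient = record
      { isLeftModuleMonomorphism = record
        { isLeftModuleHomomorphism = record
          { +ᴹ-isGroupHomomorphism = record
            { isMonoidHomomorphism = record
              { isMagmaHomomorphism = record
                { isRelHomomorphism = record { cong = λ {x} {y} → quotient-cong {x} {y} }
                ; homo = λ x y → ≗⇒≈Qc (deleteσ (x Q.+ᴹ y)) (deleteσ x Qc.+ᴹ deleteσ y) λ _ → refl
                }
              ; ε-homo = ≗⇒≈Qc (deleteσ Q.0ᴹ) Qc.0ᴹ λ _ → refl
              }
            ; ⁻¹-homo = λ x → ≗⇒≈Qc (deleteσ (Q.-ᴹ x)) (Qc.-ᴹ deleteσ x) λ _ → refl
            }
          ; *ₗ-homo = λ a x → ≗⇒≈Qc (deleteσ (a Q.*ₗ x)) (a Qc.*ₗ deleteσ x) λ _ → refl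
          }
        -- The same `c` works in `G`: `∂ *ᵥ c` and `x - y` are both cycles of `G` and agree off `σ`,
        -- hence also at `σ`.
        ; injective = λ {(x , x∈)} {(y , y∈)} (c , ∂c≗x-y) →
            c , cycle-injective (∂ *ᵥ c) (λ a → x a - y a)
                  (image-cycle c) (cycle-difference x y x∈ y∈) ∂c≗x-y
        }
      ; surjective = λ (y , y∈) → let x , x∈ , x≗y = extend y y∈ in
          (x , x∈) , λ {z} z≈x → Qc.≈ᴹ-trans {deleteσ z} {deleteσ (x , x∈)} {y , y∈}
            (quotient-cong {z} {x , x∈} z≈x) (≗⇒≈Qc (deleteσ (x , x∈)) (y , y∈) x≗y)
      }
      where
      module Q = LeftModule Q
      module Qc = LeftModule Qc

      quotient-cong : ∀ {x y} → x Q.≈ᴹ y → deleteσ x Qc.≈ᴹ deleteσ y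
      quotient-cong (c , ∂c≗x-y) = c , λ a → ∂c≗x-y (punchIn σ a)

    contract-isUnicyclizer : IsUnicyclizer G/σ ∂c
    contract-isUnicyclizer = record
      -- If `∂c` kills `c`, then `∂ *ᵥ c` is a cycle of `G` vanishing off `σ`, hence zero.
      { ker∂≡0  = λ c ∂c≗0 → ker∂≡0 c (cycle-zero (image-cycle c) ∂c≗0)
      -- A column of the product with `∂₁` unfolds to the boundary of a column, so this condition
      -- says that the columns are cycles.
      ; ∂₁∂≡0   = λ w j → removeAt-cycle (column ∂ j) (λ v → ∂₁∂≡0 v j) w
      ; corank₁ = HasRank-map Q Qc deleteσ-isIsomorphism-quotient corank₁
      }

-- Equality of winding numbers and the conclusion.

windingNumber-cong : ∀ {n e n′ e′ k} {G : Graph n e} {G′ : Graph n′ e′}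
  (𝒜 : Unicyclization G k) (𝒜′ : Unicyclization G′ k)
  (β : Basis (Z₁ G) (suc k)) (β′ : Basis (Z₁ G′) (suc k)) (z : Cycle G) (z′ : Cycle G′) →
  Basis.coordinates β z ≗ Basis.coordinates β′ z′ →
  (∀ j → Basis.coordinates β (Unicyclization.columnCycle 𝒜 j)
       ≗ Basis.coordinates β′ (Unicyclization.columnCycle 𝒜′ j)) →
  windingNumber G 𝒜 β z ≡ windingNumber G′ 𝒜′ β′ z′
windingNumber-cong 𝒜 𝒜′ β β′ z z′ z≗z′ ∂≗∂′ = det-cong
  {A = λ i → Basis.coordinates β z i ∷ λ j → Basis.coordinates β (Unicyclization.columnCycle 𝒜 j) i}
  {B = λ i → Basis.coordinates β′ z′ i ∷ λ j → Basis.coordinates β′ (Unicyclization.columnCycle 𝒜′ j) i}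
  -- Column `zero` holds the coordinates of the cycle, column `suc j` those of column `j` of the
  -- unicyclizer.
  λ { i zero → z≗z′ i ; i (suc j) → ∂≗∂′ j i }

proposition4p4p2 : ∀ {n e k : ℕ} (G : Graph (suc n) (suc e))
    (𝒜 : Unicyclization G k) (β : Basis (Z₁ G) (suc k))
    (σ : Fin (suc e)) (σ-nonloop : ¬ Graph.IsLoop G σ) →
    let G/σ = contract G σ σ-nonloop in
    Σ[ 𝒜c ∈ Unicyclization G/σ k ] Σ[ βc ∈ Basis (Z₁ G/σ) (suc k) ]
    (∀ (C : Vector ℤ (suc e)) (C∈Z₁ : IsCycle G C) →
    Σ[ Cc∈Z₁ ∈ IsCycle G/σ (removeAt C σ) ]
    (Basis.coordinates β (C , C∈Z₁) ≗ Basis.coordinates βc (removeAt C σ , Cc∈Z₁)) ×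
    (windingNumber G 𝒜 β (C , C∈Z₁) ≡ windingNumber G/σ 𝒜c βc (removeAt C σ , Cc∈Z₁)))
proposition4p4p2 {k = k} G 𝒜 β σ σ-nonloop = 𝒜c , βc , λ C C∈Z₁ →
  removeAt-cycle G σ σ-nonloop C C∈Z₁ ,
  same-coordinates (C , C∈Z₁) (removeAt C σ , removeAt-cycle G σ σ-nonloop C C∈Z₁) (λ _ → refl) ,
  windingNumber-cong {G = G} {G′ = contract G σ σ-nonloop} 𝒜 𝒜c β βc
    (C , C∈Z₁) (removeAt C σ , removeAt-cycle G σ σ-nonloop C C∈Z₁)
    (same-coordinates (C , C∈Z₁) (removeAt C σ , removeAt-cycle G σ σ-nonloop C C∈Z₁) λ _ → refl)
    -- The columns of `𝒜c` are by definition those of `𝒜` without their entry at `σ`.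
    (λ j → same-coordinates (columnCycle j) (Unicyclization.columnCycle 𝒜c j) λ _ → refl)
  where
  open Unicyclization 𝒜

  𝒜c : Unicyclization (contract G σ σ-nonloop) k
  𝒜c = record
    { ∂             = ∂ ∘ punchIn σ
    ; isUnicyclizer = contract-isUnicyclizer G σ σ-nonloop isUnicyclizer
    }

  deleteσ-iso = deleteσ-isIsomorphism G σ σ-nonloop

  βc : Basis (Z₁ (contract G σ σ-nonloop)) (suc k)
  βc = Basis-map (Z₁ G) (Z₁ (contract G σ σ-nonloop)) deleteσ-iso β

  -- Here `y` is arbitrary rather than `deleteσ x`, since the column cycles of `𝒜c` carry their own
  -- proofs of being cycles and `coordinates` takes such a proof as part of its argument.
  same-coordinates : ∀ (x : Cycle G) (y : Cycle (contract G σ σ-nonloop)) →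
    removeAt (proj₁ x) σ ≗ proj₁ y → Basis.coordinates β x ≗ Basis.coordinates βc y
  same-coordinates x y =
    coordinates-map (Z₁ G) (Z₁ (contract G σ σ-nonloop)) deleteσ-iso β {x} {y}
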